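{- Let $G$ be a connected, locally finite chordal graph. There is a bijection between the set of clique trees of $G$ and the product $\prod_{F\in\mathfrak{F}(G)}\mathcal{S}\bigl(\Gamma^{=}(F)/\sim_F\bigr)$, where $\mathcal{S}(H)$ denotes the set of spanning trees of the multigraph $H$ (spanning trees using distinct parallel edges being distinguished).
   Context: A chordal graph is a loopless graph without multiple edges with no induced cycle of length greater than $3$; chordal graphs are assumed connected; locally finite means all degrees finite. A clique is a maximal complete vertex set; $\mathcal{K}(G)$ is the set of cliques; the clique graph $\mathcal{C}(G)$ has vertex set $\mathcal{K}(G)$ and an edge between distinct intersecting cliques. A clique tree of $G$ is a spanning tree $T$ of $\mathcal{C}(G)$ such that for every vertex $v$ the induced subgraph $T[\{K: v\in K\}]$ is a tree. For a complete set $C$ (possibly empty), $F(C):=\{K\in\mathcal{K}(G):C\subseteq K\}$; $\mathfrak{F}(G)$ is the set of all such clique families. For $F\in\mathfrak{F}(G)$: $\Gamma^{=}(F)$ is the graph on $F$ with an edge $K_1K_2$ (distinct, intersecting $K_1,K_2\in F$) whenever $F(K_1\cap K_2)=F$; $\Gamma^{<}(F)$ is the graph on $F$ with an edge $K_1K_2$ (distinct, intersecting) whenever $F(K_1\cap K_2)\subsetneq F$; $\sim_F$ is the equivalence relation whose classes are the connected components of $\Gamma^{<}(F)$; $\Gamma^{=}(F)/\sim_F$ is the multigraph obtained from $\Gamma^{=}(F)$ by contracting each $\sim_F$-class to a single vertex, each edge keeping its identity. -}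

module Defs where

open import Level using (Level) renaming (zero to 0ℓ; suc to lsuc)
open import Data.Nat using (ℕ; zero; suc; _≤_)
open import Data.Fin using (Fin; toℕ)
open import Data.List using (List)
open import Data.List.Membership.Propositional using (_∈_)
open import Data.Product using (Σ; _×_; _,_; proj₁; proj₂; ∃)
open import Data.Sum using (_⊎_; inj₁; inj₂)
open import Data.Unit using (⊤)
open import Data.Empty using (⊥)
open import Relation.Nullary using (¬_)
open import Relation.Binary.PropositionalEquality using (_≡_; _≢_)
open import Relation.Binary.Bundles using (Setoid)
open import Function using (id; _∘_)

record Graph : Set₁ where
  field
    V     : Set
    _∼_   : V → V → Set
    irrefl : ∀ {u} → ¬ (u ∼ u)
    sym∼   : ∀ {u w} → u ∼ w → w ∼ u

_⇔_ : ∀ {a b} → Set a → Set b → Set _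
A ⇔ B = (A → B) × (B → A)

CycSucc : (k : ℕ) → Fin k → Fin k → Set
CycSucc k i j = (suc (toℕ i) ≡ toℕ j) ⊎ ((suc (toℕ i) ≡ k) × (toℕ j ≡ 0))

module _ (G : Graph) where
  open Graph G

  data Path : V → V → Set where
    here  : ∀ {u v} → u ≡ v → Path u v
    there : ∀ {u w v} → u ∼ w → Path w v → Path u v

  Connected : Set
  Connected = ∀ u v → Path u v

  LocallyFinite : Set
  LocallyFinite = ∀ v → Σ (List V) λ l → ∀ w → v ∼ w → w ∈ l

  IsInducedCycle : (k : ℕ) → (Fin k → V) → Set
  IsInducedCycle k c =
    (∀ i j → c i ≡ c j → i ≡ j) ×
    (∀ i j → (c i ∼ c j) ⇔ (CycSucc k i j ⊎ CycSucc k j i))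

  Chordal : Set
  Chordal = ∀ k → 4 ≤ k → (c : Fin k → V) → ¬ IsInducedCycle k c

  VSet : Set₁
  VSet = V → Set

  _⊆_ : VSet → VSet → Set
  A ⊆ B = ∀ v → A v → B v

  _∩_ : VSet → VSet → VSet
  (A ∩ B) v = A v × B v

  IsComplete : VSet → Set
  IsComplete C = ∀ u w → C u → C w → u ≢ w → u ∼ w

  IsClique : VSet → Set₁
  IsClique K = IsComplete K × (∀ C → IsComplete C → K ⊆ C → C ⊆ K)

  Clique : Set₁
  Clique = Σ VSet IsClique

  _≈K_ : Clique → Clique → Set
  K ≈K K' = ∀ v → proj₁ K v ⇔ proj₁ K' v

  Intersect : Clique → Clique → Set
  Intersect K K' = ∃ λ v → proj₁ K v × proj₁ K' v

  CEdge : Clique → Clique → Set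
  CEdge K K' = ¬ (K ≈K K') × Intersect K K'

  CompleteSet : Set₁
  CompleteSet = Σ VSet IsComplete

  InF : VSet → Clique → Set
  InF C K = C ⊆ proj₁ K

  _≐F_ : VSet → VSet → Set₁
  C ≐F D = ∀ K → InF C K ⇔ InF D K

  _⊂F_ : VSet → VSet → Set₁
  C ⊂F D = (∀ K → InF C K → InF D K) × ¬ (C ≐F D)

  EqEdge : CompleteSet → Clique → Clique → Set₁
  EqEdge C K₁ K₂ = InF (proj₁ C) K₁ × InF (proj₁ C) K₂ × CEdge K₁ K₂
                   × ((proj₁ K₁ ∩ proj₁ K₂) ≐F proj₁ C)

  LtEdge : CompleteSet → Clique → Clique → Set₁
  LtEdge C K₁ K₂ = InF (proj₁ C) K₁ × InF (proj₁ C) K₂ × CEdge K₁ K₂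
                   × ((proj₁ K₁ ∩ proj₁ K₂) ⊂F proj₁ C)

  data SimF (C : CompleteSet) : Clique → Clique → Set₁ where
    same : ∀ {A B} → A ≈K B → SimF C A B
    step : ∀ {A X B} → LtEdge C A X → SimF C X B → SimF C A B

  -- Trees in a (possibly contracted) graph whose edges are unordered
  -- pairs of cliques.  Data:
  --   P   : vertex set (a predicate on cliques),
  --   _~_ : identification of vertices (≈K for C(G), ∼_F for Γ^=(F)/∼_F),
  --   R   : the selected edge set, as a symmetric relation on cliques.
  -- An edge {A,B} joins the ~-class of A and the ~-class of B.

  SameEdge : Clique → Clique → Clique → Clique → Set
  SameEdge A B A' B' = (A ≈K A' × B ≈K B') ⊎ (A ≈K B' × B ≈K A')

  module _ {ℓp ℓs ℓr} (P : Clique → Set ℓp) (_~_ : Clique → Clique → Set ℓs)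
           (R : Clique → Clique → Set ℓr) where

    data Walk : Clique → Clique → Set (lsuc 0ℓ Level.⊔ ℓp Level.⊔ ℓs Level.⊔ ℓr) where
      done : ∀ {A B} → A ~ B → Walk A B
      step : ∀ {A B} A' X → A ~ A' → R A' X → P X → Walk X B → Walk A B

    IsConnectedOn : Set _
    IsConnectedOn = ∀ A B → P A → P B → Walk A B

    -- a cycle of length k ≥ 1 (loops for k = 1, pairs of distinct parallel
    -- edges for k = 2): distinct vertices c i, distinct edges {a i, b i},
    -- edge i joining c i and c (i+1 mod k)
    IsCycle : (k : ℕ) → (c a b : Fin k → Clique) → Set _
    IsCycle k c a b =
      (∀ i → P (c i)) ×
      (∀ i → R (a i) (b i)) ×
      (∀ i → a i ~ c i) ×
      (∀ i j → CycSucc k i j → b i ~ c j) ×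
      (∀ i j → i ≢ j → ¬ (c i ~ c j)) ×
      (∀ i j → i ≢ j → ¬ SameEdge (a i) (b i) (a j) (b j))

    IsAcyclicOn : Set _
    IsAcyclicOn = ∀ k → 1 ≤ k → (c a b : Fin k → Clique) → ¬ IsCycle k c a b

    IsTreeOn : Set _
    IsTreeOn = IsConnectedOn × IsAcyclicOn

  IsEdgeSubset : ∀ {ℓ} → (Clique → Clique → Set ℓ) → (Clique → Clique → Set) → Set (lsuc 0ℓ Level.⊔ ℓ)
  IsEdgeSubset E R = (∀ A B → R A B → E A B) × (∀ A B → R A B → R B A)
                     × (∀ A A' B B' → A ≈K A' → B ≈K B' → R A B → R A' B')

  EdgeRel : Set₁
  EdgeRel = Clique → Clique → Set

  IsCliqueTree : EdgeRel → Set₁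
  IsCliqueTree T = IsEdgeSubset CEdge T
                 × IsTreeOn (λ _ → ⊤) _≈K_ T
                 × (∀ v → IsTreeOn (λ K → proj₁ K v) _≈K_ T)

  IsSpanningTreeQ : CompleteSet → EdgeRel → Set₁
  IsSpanningTreeQ C S = IsEdgeSubset (EqEdge C) S
                      × IsTreeOn (InF (proj₁ C)) (SimF C) S

  CliqueTrees : Setoid (lsuc 0ℓ) (lsuc 0ℓ)
  CliqueTrees = record
    { Carrier = Σ EdgeRel IsCliqueTree
    ; _≈_ = λ T T' → ∀ A B → proj₁ T A B ⇔ proj₁ T' A B
    ; isEquivalence = record
      { refl = λ A B → id , id
      ; sym = λ e A B → proj₂ (e A B) , proj₁ (e A B)
      ; trans = λ e f A B → proj₁ (f A B) ∘ proj₁ (e A B) , proj₂ (e A B) ∘ proj₂ (f A B)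
      }
    }

  -- ∏_{F ∈ 𝔉(G)} 𝒮(Γ^=(F)/∼_F): the index set 𝔉(G) is presented by the
  -- complete sets C, and the component chosen for C depends only on F(C).
  ProductCarrier : Set₁
  ProductCarrier =
    Σ (CompleteSet → EdgeRel) λ S →
      (∀ C → IsSpanningTreeQ C (S C)) ×
      (∀ C D → proj₁ C ≐F proj₁ D → ∀ A B → S C A B ⇔ S D A B)

  SpanningTreeProduct : Setoid (lsuc 0ℓ) (lsuc 0ℓ)
  SpanningTreeProduct = record
    { Carrier = ProductCarrier
    ; _≈_ = λ S S' → ∀ C A B → proj₁ S C A B ⇔ proj₁ S' C A B
    ; isEquivalence = record
      { refl = λ C A B → id , id
      ; sym = λ e C A B → proj₂ (e C A B) , proj₁ (e C A B)
      ; trans = λ e f C A B → proj₁ (f C A B) ∘ proj₁ (e C A B) , proj₂ (e C A B) ∘ proj₂ (f C A B)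
      }
    }

{-# OPTIONS --safe #-}
-- A clique tree T is sent to its restrictions S_F, the edges AB of T with F(A ∩ B) = F; conversely a
-- family (S_F) is glued to the union of its members, each edge AB lying in the factor F = F(A ∩ B).
-- Acyclicity is used in the form "every edge is a bridge".
--
-- T ↦ (S_F): the T-path from A to B runs through cliques containing A ∩ B, so its edges are either
-- S_F-edges or Γ^<(F)-edges, and the T-path between two ∼_F-equivalent cliques uses no S_F-edge.
--
-- (S_F) ↦ T: connectedness is an induction on the vertices outside C, for F = F(C).  On a cycle choose
-- an edge with inclusion-minimal intersection C.  The other edges whose intersection is C lie in the
-- same factor, and a stretch of edges whose intersections are not contained in C gives a path of G − C;
-- taking it shortest, chordality makes all its vertices adjacent to all of C, so the stretch joins
-- ∼_F-equivalent cliques.  Thus the cycle closes up in Γ^=(F)/∼_F, contradicting acyclicity of S_F.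
module Submission where

open import Defs
open import Level using (Level; _⊔_) renaming (zero to 0ℓ; suc to lsuc)
open import Axiom.ExcludedMiddle using (ExcludedMiddle)
open import Function.Bundles using (Bijection)

open import Data.Nat using (ℕ; zero; suc; _+_; _∸_; _≤_; _<_; z≤n; s≤s)
open import Data.Nat.Properties
  using ( ≤-refl; ≤-reflexive; ≤-trans; ≤-antisym; ≤-pred; ≤-total; <-trans; <-≤-trans; <-irrefl; <⇒≤; <-cmp
        ; >⇒≢; <⇒≢; n<1+n; m≤m+n; m<n⇒m<1+n; m≤n⇒m<n∨m≡n; m≢1+n+m; suc-injective
        ; +-comm; +-suc; +-identityʳ; +-cancelˡ-≤; +-cancelˡ-≡; +-monoʳ-≤; +-monoʳ-<; +-monoˡ-<
        ; m+[n∸m]≡n; m∸n+n≡m )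
open import Data.Nat.Induction using (<-wellFounded)
open import Data.Fin using (Fin; zero; suc; toℕ; fromℕ<)
open import Data.Fin.Properties using (toℕ<n; toℕ-injective; toℕ-fromℕ<)
open import Data.Fin.Induction using (spo-wellFounded)
open import Data.List using (List; []; _∷_; length; filter)
open import Data.List.Properties using (filter-notAll)
open import Data.List.Relation.Unary.Any using (here; there)
import Data.List.Relation.Unary.Any as Any
open import Data.List.Membership.Propositional using (_∈_)
open import Data.List.Membership.Propositional.Properties using (∈-filter⁺)
open import Data.Product using (Σ; _×_; _,_; proj₁; proj₂; ∃; swap)
import Data.Sum as Sum
open import Data.Sum using (_⊎_; inj₁; inj₂)
open import Data.Unit using (⊤; tt)
open import Data.Empty using (⊥; ⊥-elim)
open import Function using (id; _∘_)
open import Induction.WellFounded using (Acc; acc; WellFounded)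
open import Relation.Nullary using (¬_; Dec; yes; no; contradiction)
open import Relation.Nullary.Decidable using (True; toWitness; fromWitness; decidable-stable)
open import Relation.Binary using (Setoid; Rel; IsEquivalence; tri<; tri≈; tri>)
open import Relation.Binary.PropositionalEquality
  using (_≡_; _≢_; refl; sym; trans; cong; subst; isEquivalence; resp₂)
open import Relation.Binary.Construct.Closure.ReflexiveTransitive
  using (Star; ε; _◅_; _◅◅_; _⋆; return) renaming (map to Star-map)

-- Walks as sequences of vertices, and shortest walks

stretch : ∀ {x f} {X : Set x} {F : Rel X f} (p : ℕ → X) {i j} → i ≤ j →
          (∀ l → i ≤ l → l < j → F (p l) (p (suc l))) → Star F (p i) (p j)
stretch {F = F} p {i} {j} i≤j edge =
  subst (λ n → Star F (p i) (p n)) (m+[n∸m]≡n i≤j)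
    (go (j ∸ i) (λ l i≤l l< → edge l i≤l (subst (l <_) (m+[n∸m]≡n i≤j) l<)))
  where
  go : ∀ d → (∀ l → i ≤ l → l < i + d → F (p l) (p (suc l))) → Star F (p i) (p (i + d))
  go zero edge′ = subst (λ n → Star F (p i) (p n)) (sym (+-identityʳ i)) ε
  go (suc d) edge′ =
    subst (λ n → Star F (p i) (p n)) (sym (+-suc i d))
      (go d (λ l i≤l l< → edge′ l i≤l (<-trans l< (+-monoʳ-< i (n<1+n d))))
        ◅◅ return (edge′ (i + d) (m≤m+n i d) (+-monoʳ-< i (n<1+n d))))

module ShortestWalk
  {x ℓ e : Level} {X : Set x} {_~_ : Rel X ℓ} (~-equiv : IsEquivalence _~_)
  {E : Rel X e} (E-resp : ∀ {s s′ t t′} → s ~ s′ → t ~ t′ → E s t → E s′ t′)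
  where
  open IsEquivalence ~-equiv renaming (refl to ~-refl; sym to ~-sym; trans to ~-trans)

  -- The sequence is total on ℕ so that walks can be cut and shifted without `Fin` arithmetic; only
  -- the entries 0, ..., n count. The ends are fixed up to `~` because the vertices may be classes
  -- under `~`.
  record WalkOf (n : ℕ) (s t : X) : Set (x ⊔ ℓ ⊔ e) where
    field
      at    : ℕ → X
      start : s ~ at 0
      end   : at n ~ t
      edge  : ∀ j → j < n → E (at j) (at (suc j))
  open WalkOf

  infixr 5 _∷ʷ_ _++ʷ_

  reroute : ∀ {n s s′ t} → s ~ s′ → WalkOf n s′ t → WalkOf n s t
  reroute r w = record { at = at w ; start = ~-trans r (start w) ; end = end w ; edge = edge w }

  _∷ʷ_ : ∀ {n s u t} → E s u → WalkOf n u t → WalkOf (suc n) s t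
  _∷ʷ_ {n} {s} {u} {t} r w = record { at = at′ ; start = ~-refl ; end = end w ; edge = edge′ }
    where
    at′ : ℕ → X
    at′ zero    = s
    at′ (suc j) = at w j
    edge′ : ∀ j → j < suc n → E (at′ j) (at′ (suc j))
    edge′ zero    _       = E-resp ~-refl (start w) r
    edge′ (suc j) (s≤s q) = edge w j q

  take : ∀ {n s t} i → i ≤ n → (w : WalkOf n s t) → WalkOf i s (at w i)
  take i i≤n w = record
    { at = at w ; start = start w ; end = ~-refl ; edge = λ j j<i → edge w j (<-≤-trans j<i i≤n) }

  drop : ∀ {n s t} i → i ≤ n → (w : WalkOf n s t) → WalkOf (n ∸ i) (at w i) t
  drop {n} {t = t} i i≤n w = record
    { at    = λ j → at w (j + i)
    ; start = ~-refl
    ; end   = subst (λ m → at w m ~ t) (sym (m∸n+n≡m i≤n)) (end w)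
    ; edge  = λ j j< → edge w (j + i) (subst (j + i <_) (m∸n+n≡m i≤n) (+-monoˡ-< i j<))
    }

  _++ʷ_ : ∀ {m n s u t} → WalkOf m s u → WalkOf n u t → WalkOf (m + n) s t
  _++ʷ_ {zero}  w w′ = reroute (~-trans (start w) (end w)) w′
  _++ʷ_ {suc m} w w′ =
    E-resp (~-sym (start w)) ~-refl (edge w 0 (s≤s z≤n)) ∷ʷ
      (record { at = at w ∘ suc ; start = ~-refl ; end = end w ; edge = λ j j<m → edge w (suc j) (s≤s j<m) }
        ++ʷ w′)

  -- Moves along `~` are absorbed by `reroute`, so the length counts only the `E`-steps.
  fromStar : ∀ {s t} → Star (λ u v → (u ~ v) ⊎ E u v) s t → ∃ λ n → WalkOf n s t
  fromStar {s} ε = 0 , record { at = λ _ → s ; start = ~-refl ; end = ~-refl ; edge = λ _ () }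
  fromStar (inj₁ r ◅ rs) = let n , w = fromStar rs in n , reroute r w
  fromStar (inj₂ r ◅ rs) = let n , w = fromStar rs in suc n , r ∷ʷ w

  Shortest : ∀ {n s t} → WalkOf n s t → Set (x ⊔ ℓ ⊔ e)
  Shortest {n} {s} {t} _ = ∀ m → m < n → ¬ WalkOf m s t

  shortest : ExcludedMiddle (x ⊔ ℓ ⊔ e) → ∀ {s t} → Star (λ u v → (u ~ v) ⊎ E u v) s t →
             ∃ λ n → Σ (WalkOf n s t) Shortest
  shortest em {s} {t} rs = let n , w = fromStar rs in go n (<-wellFounded n) w
    where
    go : ∀ n → Acc _<_ n → WalkOf n s t → ∃ λ n → Σ (WalkOf n s t) Shortest
    go n (acc rec) w with em {∃ λ m → m < n × WalkOf m s t}
    ... | yes (m , m<n , w′) = go m (rec m<n) w′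
    ... | no  none           = n , w , λ m m<n w′ → none (m , m<n , w′)

  module _ {n : ℕ} {s t : X} (w : WalkOf n s t) (min : Shortest w) where

    shortest-<⇒≁ : ∀ {i j} → i < j → j ≤ n → ¬ (at w i ~ at w j)
    shortest-<⇒≁ {i} {j} i<j j≤n r =
      min (i + (n ∸ j)) (subst (i + (n ∸ j) <_) (m+[n∸m]≡n j≤n) (+-monoˡ-< (n ∸ j) i<j))
        (take i (≤-trans (<⇒≤ i<j) j≤n) w ++ʷ reroute r (drop j j≤n w))

    shortest-injective : ∀ {i j} → i ≤ n → j ≤ n → at w i ~ at w j → i ≡ j
    shortest-injective {i} {j} i≤n j≤n r with <-cmp i j
    ... | tri< i<j _ _ = ⊥-elim (shortest-<⇒≁ i<j j≤n r)
    ... | tri≈ _ i≡j _ = i≡j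
    ... | tri> _ _ j<i = ⊥-elim (shortest-<⇒≁ j<i i≤n (~-sym r))

    -- A chord would replace at least two edges by one, leaving a walk of length i + 1 + (n - j) <
    -- n.
    shortest-chordless : ∀ {i j} → suc i < j → j ≤ n → ¬ E (at w i) (at w j)
    shortest-chordless {i} {j} i+1<j j≤n r =
      min (i + suc (n ∸ j))
        (subst (_< n) (sym (+-suc i (n ∸ j)))
          (subst (suc i + (n ∸ j) <_) (m+[n∸m]≡n j≤n) (+-monoˡ-< (n ∸ j) i+1<j)))
        (take i (≤-trans (<⇒≤ (<-trans (n<1+n i) i+1<j)) j≤n) w ++ʷ r ∷ʷ drop j j≤n w)

-- Searching along a sequence, and minimal elements

module Gaps (em : ExcludedMiddle 0ℓ) (Q : ℕ → Set) where

  last-before : ∀ n → Q 0 → ¬ Q n → ∃ λ i → i < n × Q i × (∀ x → i < x → x ≤ n → ¬ Q x)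
  last-before zero    q0 ¬qn = contradiction q0 ¬qn
  last-before (suc n) q0 ¬qn with em {Q n}
  ... | yes qn = n , ≤-refl , qn , λ x n<x x≤ → subst (¬_ ∘ Q) (≤-antisym n<x x≤) ¬qn
  ... | no ¬qn′ with last-before n q0 ¬qn′
  ...   | i , i<n , qi , none = i , m<n⇒m<1+n i<n , qi , none′
    where
    none′ : ∀ x → i < x → x ≤ suc n → ¬ Q x
    none′ x i<x x≤ with m≤n⇒m<n∨m≡n x≤
    ... | inj₁ (s≤s x≤n) = none x i<x x≤n
    ... | inj₂ refl      = ¬qn

  -- The horizon is written n + d so that the search recurses on the distance d.
  first-after : ∀ d n → ¬ Q n → Q (n + d) →
                ∃ λ k → n < k × k ≤ n + d × Q k × (∀ x → n ≤ x → x < k → ¬ Q x)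
  first-after zero n ¬qn q = contradiction (subst Q (+-identityʳ n) q) ¬qn
  first-after (suc d) n ¬qn q with em {Q (suc n)}
  ... | yes q′ = suc n , ≤-refl , subst (suc n ≤_) (sym (+-suc n d)) (s≤s (m≤m+n n d)) , q′ ,
                 λ x n≤x x<k → subst (¬_ ∘ Q) (≤-antisym n≤x (≤-pred x<k)) ¬qn
  ... | no ¬q′ with first-after d (suc n) ¬q′ (subst Q (+-suc n d) q)
  ...   | k , n<k , k≤ , qk , none = k , <-trans (n<1+n n) n<k , subst (k ≤_) (sym (+-suc n d)) k≤ , qk , none′
    where
    none′ : ∀ x → n ≤ x → x < k → ¬ Q x
    none′ x n≤x x<k with m≤n⇒m<n∨m≡n n≤x
    ... | inj₁ n<x  = none x n<x x<k
    ... | inj₂ refl = ¬qn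

minimal : ExcludedMiddle 0ℓ → ∀ {n} {_⊏_ : Rel (Fin n) 0ℓ} → WellFounded _⊏_ → Fin n →
          ∃ λ i → ∀ j → ¬ (j ⊏ i)
minimal em {n} {_⊏_} wf i = go i (wf i)
  where
  go : ∀ i → Acc _⊏_ i → ∃ λ i → ∀ j → ¬ (j ⊏ i)
  go i (acc rec) with em {∃ λ j → j ⊏ i}
  ... | yes (j , j⊏i) = go j (rec j⊏i)
  ... | no  none      = i , λ j j⊏i → none (j , j⊏i)

-- Chordality and shortest paths avoiding a vertex set

module Chordality (em : ExcludedMiddle 0ℓ) (G : Graph) (chordal : Chordal G) where
  open Graph G

  -- Since q is an induced path and c sees only its two ends, c and q 0, ..., q d form an induced
  -- cycle of length d + 2 ≥ 4.
  no-wheel-gap : ∀ (q : ℕ → V) (c : V) d → 2 ≤ d →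
    (∀ {x y} → x ≤ d → y ≤ d → q x ≡ q y → x ≡ y) →
    (∀ {x} → x < d → q x ∼ q (suc x)) →
    (∀ {x y} → suc x < y → y ≤ d → ¬ (q x ∼ q y)) →
    (∀ {x} → x ≤ d → c ≢ q x) →
    c ∼ q 0 → c ∼ q d → (∀ {x} → 0 < x → x < d → ¬ (c ∼ q x)) → ⊥
  no-wheel-gap q c d 2≤d inj edge chordless c∉q c∼q₀ c∼qd gap =
    chordal (2 + d) (s≤s (s≤s 2≤d)) cyc (cyc-injective , cyc-adjacent)
    where
    cyc : Fin (2 + d) → V
    cyc zero    = c
    cyc (suc i) = q (toℕ i)

    bound : (i : Fin (suc d)) → toℕ i ≤ d
    bound i = ≤-pred (toℕ<n i)

    cyc-injective : ∀ i j → cyc i ≡ cyc j → i ≡ j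
    cyc-injective zero    zero    _  = refl
    cyc-injective zero    (suc j) eq = ⊥-elim (c∉q (bound j) eq)
    cyc-injective (suc i) zero    eq = ⊥-elim (c∉q (bound i) (sym eq))
    cyc-injective (suc i) (suc j) eq = cong suc (toℕ-injective (inj (bound i) (bound j) eq))

    rim : ∀ (j : Fin (suc d)) →
          (c ∼ q (toℕ j)) ⇔ (CycSucc (2 + d) zero (suc j) ⊎ CycSucc (2 + d) (suc j) zero)
    rim j = to , from
      where
      to : c ∼ q (toℕ j) → CycSucc (2 + d) zero (suc j) ⊎ CycSucc (2 + d) (suc j) zero
      to c∼qj with m≤n⇒m<n∨m≡n (bound j)
      ... | inj₂ j≡d = inj₂ (inj₂ (cong (2 +_) j≡d , refl))
      ... | inj₁ j<d with m≤n⇒m<n∨m≡n (z≤n {toℕ j})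
      ...   | inj₁ 0<j = ⊥-elim (gap 0<j j<d c∼qj)
      ...   | inj₂ 0≡j = inj₁ (inj₁ (cong suc 0≡j))
      from : CycSucc (2 + d) zero (suc j) ⊎ CycSucc (2 + d) (suc j) zero → c ∼ q (toℕ j)
      from (inj₁ (inj₁ eq))       = subst (λ n → c ∼ q n) (suc-injective eq) c∼q₀
      from (inj₂ (inj₂ (eq , _))) = subst (λ n → c ∼ q n) (sym (suc-injective (suc-injective eq))) c∼qd

    cyc-adjacent : ∀ i j → (cyc i ∼ cyc j) ⇔ (CycSucc (2 + d) i j ⊎ CycSucc (2 + d) j i)
    cyc-adjacent zero zero = ⊥-elim ∘ irrefl , λ { (inj₁ (inj₁ ())) ; (inj₁ (inj₂ (() , _)))
                                                  ; (inj₂ (inj₁ ())) ; (inj₂ (inj₂ (() , _))) }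
    cyc-adjacent zero    (suc j) = rim j
    cyc-adjacent (suc i) zero    = Sum.swap ∘ proj₁ (rim i) ∘ sym∼ , sym∼ ∘ proj₂ (rim i) ∘ Sum.swap
    cyc-adjacent (suc i) (suc j) = to , from
      where
      to : q (toℕ i) ∼ q (toℕ j) → CycSucc (2 + d) (suc i) (suc j) ⊎ CycSucc (2 + d) (suc j) (suc i)
      to r with <-cmp (toℕ i) (toℕ j)
      ... | tri≈ _ eq _ = ⊥-elim (irrefl (subst (λ n → q n ∼ q (toℕ j)) eq r))
      ... | tri< i<j _ _ with m≤n⇒m<n∨m≡n i<j
      ...   | inj₁ lt = ⊥-elim (chordless lt (bound j) r)
      ...   | inj₂ eq = inj₁ (inj₁ (cong suc eq))
      to r | tri> _ _ j<i with m≤n⇒m<n∨m≡n j<i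
      ...   | inj₁ lt = ⊥-elim (chordless lt (bound i) (sym∼ r))
      ...   | inj₂ eq = inj₂ (inj₁ (cong suc eq))
      from : CycSucc (2 + d) (suc i) (suc j) ⊎ CycSucc (2 + d) (suc j) (suc i) → q (toℕ i) ∼ q (toℕ j)
      from (inj₁ (inj₁ eq)) =
        subst (λ n → q (toℕ i) ∼ q n) (suc-injective eq)
          (edge (subst (_≤ d) (sym (suc-injective eq)) (bound j)))
      from (inj₂ (inj₁ eq)) =
        sym∼ (subst (λ n → q (toℕ j) ∼ q n) (suc-injective eq)
          (edge (subst (_≤ d) (sym (suc-injective eq)) (bound i))))

  module AvoidingWalk (C : V → Set) where

    Avoid : Rel V 0ℓ
    Avoid u w = (u ∼ w) × ¬ C u × ¬ C w

    Avoid-resp : ∀ {u u′ w w′} → u ≡ u′ → w ≡ w′ → Avoid u w → Avoid u′ w′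
    Avoid-resp refl refl r = r

    open ShortestWalk {_~_ = _≡_} isEquivalence {E = Avoid} Avoid-resp public
    open WalkOf

    -- If c missed p_j, take the last neighbour p_i of c before p_j and the first one p_k after it:
    -- c and the segment from p_i to p_k form a forbidden induced cycle.
    common-neighbours : ∀ {n u w} (p : WalkOf n u w) → Shortest p → (∀ {j} → j ≤ n → ¬ C (at p j)) →
      ∀ {c} → C c → c ∼ u → c ∼ w → ∀ j → j ≤ n → c ∼ at p j
    common-neighbours {n} {u} {w} p min p∉C {c} c∈C c∼u c∼w j j≤n = decidable-stable em λ ¬c∼pj →
      let open Gaps em (λ i → c ∼ at p i)
          i , i<j , c∼pi , none₁ = last-before j (subst (c ∼_) (start p) c∼u) ¬c∼pj
          k , j<k , k≤ , c∼pk , none₂ = first-after (n ∸ j) j ¬c∼pj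
            (subst (λ m → c ∼ at p m) (sym (m+[n∸m]≡n j≤n)) (subst (c ∼_) (sym (end p)) c∼w))
          k≤n = subst (k ≤_) (m+[n∸m]≡n j≤n) k≤
          d = k ∸ i
          i+d≡k = m+[n∸m]≡n (<⇒≤ (<-trans i<j j<k))
          up : ∀ {x} → x ≤ d → i + x ≤ k
          up {x} x≤d = subst (i + x ≤_) i+d≡k (+-monoʳ-≤ i x≤d)
          up′ : ∀ {x} → x ≤ d → i + x ≤ n
          up′ x≤d = ≤-trans (up x≤d) k≤n
          gap : ∀ {x} → 0 < x → x < d → ¬ (c ∼ at p (i + x))
          gap {x} 0<x x<d = Sum.[ none₁ (i + x) (subst (_< i + x) (+-identityʳ i) (+-monoʳ-< i 0<x))
                                , (λ ge → none₂ (i + x) ge (subst (i + x <_) i+d≡k (+-monoʳ-< i x<d)))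
                                ]′ (≤-total (i + x) j)
      in no-wheel-gap (λ x → at p (i + x)) c d
           -- k - i ≥ 2 because i < j < k.
           (+-cancelˡ-≤ i 2 d (subst (i + 2 ≤_) (sym i+d≡k)
             (subst (_≤ k) (+-comm 2 i) (≤-trans (s≤s i<j) j<k))))
           (λ {x} {y} x≤ y≤ eq → +-cancelˡ-≡ i x y (shortest-injective p min (up′ x≤) (up′ y≤) eq))
           (λ {x} x<d → subst (λ m → at p (i + x) ∼ at p m) (sym (+-suc i x))
             (proj₁ (edge p (i + x) (<-≤-trans (+-monoʳ-< i x<d) (up′ ≤-refl)))))
           -- A chord in G is also a chord in G - C, as all vertices of the path lie outside C.
           (λ {x} {y} lt y≤ r → shortest-chordless p min
             (subst (_< i + y) (+-suc i x) (+-monoʳ-< i lt)) (up′ y≤)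
             (r , p∉C (up′ (≤-trans (<⇒≤ (<-trans (n<1+n x) lt)) y≤)) , p∉C (up′ y≤)))
           (λ x≤ eq → p∉C (up′ x≤) (subst C eq c∈C))
           (subst (λ m → c ∼ at p m) (sym (+-identityʳ i)) c∼pi)
           (subst (λ m → c ∼ at p m) (sym i+d≡k) c∼pk)
           gap

-- Walks, bridges and cycles in quotients of graphs on cliques

module Quotients (G : Graph) where

  infix 4 _≈_
  _≈_ : Clique G → Clique G → Set
  _≈_ = _≈K_ G

  ≈-refl : ∀ {A} → A ≈ A
  ≈-refl v = id , id

  ≈-sym : ∀ {A B} → A ≈ B → B ≈ A
  ≈-sym e v = swap (e v)

  ≈-trans : ∀ {A B D} → A ≈ B → B ≈ D → A ≈ D
  ≈-trans e f v = proj₁ (f v) ∘ proj₁ (e v) , proj₂ (e v) ∘ proj₂ (f v)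

  ≈-isEquivalence : IsEquivalence _≈_
  ≈-isEquivalence = record
    { refl  = λ {A} → ≈-refl {A}
    ; sym   = λ {A} {B} → ≈-sym {A} {B}
    ; trans = λ {A} {B} {D} → ≈-trans {A} {B} {D}
    }

  SameEdge-sym : ∀ {A B X Y} → SameEdge G A B X Y → SameEdge G X Y A B
  SameEdge-sym {A} {B} {X} {Y} (inj₁ (e , f)) = inj₁ (≈-sym {A} {X} e , ≈-sym {B} {Y} f)
  SameEdge-sym {A} {B} {X} {Y} (inj₂ (e , f)) = inj₂ (≈-sym {B} {X} f , ≈-sym {A} {Y} e)

  module _ {ℓp ℓs ℓr} (P : Clique G → Set ℓp) (_~_ : Rel (Clique G) ℓs) (R : Rel (Clique G) ℓr) where

    Link : Rel (Clique G) (ℓp ⊔ ℓs ⊔ ℓr)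
    Link A B = (A ~ B) ⊎ (R A B × P A × P B)

    -- The edge ab is deleted in both orientations and for all representatives up to `≈`, while an
    -- edge parallel to it between the same `~`-classes survives.
    Detour : Clique G → Clique G → Rel (Clique G) (ℓp ⊔ ℓs ⊔ ℓr)
    Detour a b A B = (A ~ B) ⊎ (R A B × P A × ¬ SameEdge G A B a b)

    module _ (~-equiv : IsEquivalence _~_) where
      open IsEquivalence ~-equiv renaming (refl to ~-refl; sym to ~-sym; trans to ~-trans)

      Star⇒Walk : ∀ {A B} → Star Link A B → Walk G P _~_ R A B
      Star⇒Walk ε = done ~-refl
      Star⇒Walk (inj₁ A~X ◅ rs) = reroute (Star⇒Walk rs)
        where
        reroute : ∀ {B} → Walk G P _~_ R _ B → Walk G P _~_ R _ B
        reroute (done X~B)             = done (~-trans A~X X~B)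
        reroute (step A′ Y X~A′ r p w) = step A′ Y (~-trans A~X X~A′) r p w
      Star⇒Walk (inj₂ (r , _ , p) ◅ rs) = step _ _ ~-refl r p (Star⇒Walk rs)

      module _ (P-resp : ∀ {A B} → A ~ B → P A → P B) where

        Walk⇒Star : ∀ {A B} → P A → Walk G P _~_ R A B → Star Link A B
        Walk⇒Star _ (done A~B)              = return (inj₁ A~B)
        Walk⇒Star a (step A′ X A~A′ r p w) =
          inj₁ A~A′ ◅ inj₂ (r , P-resp A~A′ a , p) ◅ Walk⇒Star p w

  module _ {P : Clique G → Set} {ℓs} {_~_ : Rel (Clique G) ℓs} {R : Rel (Clique G) 0ℓ}
    (~-equiv : IsEquivalence _~_) (≈⇒~ : ∀ {A B} → A ≈ B → A ~ B)
    (P-resp : ∀ {A B} → A ~ B → P A → P B)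
    (em : ExcludedMiddle (lsuc 0ℓ ⊔ ℓs)) where
    open IsEquivalence ~-equiv renaming (refl to ~-refl; sym to ~-sym; trans to ~-trans)

    module Closing {a b : Clique G} (a∈P : P a) (ab∈R : R a b) where

      -- Adjacency of the classes of A and B once ab is deleted; the witness `A′`, `B′` is the
      -- actual edge, which keeps its identity under contraction.
      E : Rel (Clique G) (lsuc 0ℓ ⊔ ℓs)
      E A B = ∃ λ A′ → ∃ λ B′ → (A′ ~ A) × (B′ ~ B) × R A′ B′ × P A′ × ¬ SameEdge G A′ B′ a b

      E-resp : ∀ {A A′ B B′} → A ~ A′ → B ~ B′ → E A B → E A′ B′
      E-resp A~ B~ (X , Y , e , f , rest) = X , Y , ~-trans e A~ , ~-trans f B~ , rest

      open ShortestWalk ~-equiv {E = E} E-resp public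
      open WalkOf

      module _ {m : ℕ} (w : WalkOf m b a) (min : Shortest w) where

        bound : (i : Fin (suc m)) → toℕ i ≤ m
        bound i = ≤-pred (toℕ<n i)

        vertex∈P : ∀ {j} → j ≤ m → P (at w j)
        vertex∈P {j} j≤m with m≤n⇒m<n∨m≡n j≤m
        ... | inj₁ j<m  = let _ , _ , e , _ , _ , p , _ = edge w j j<m in P-resp e p
        ... | inj₂ refl = P-resp (~-sym (end w)) a∈P

        -- The cycle follows the walk from b to a and returns by ab itself at index m. Recording the
        -- case that occurs separates the index arguments from the choice of the edges.
        Position : Fin (suc m) → Clique G → Clique G → Set (lsuc 0ℓ ⊔ ℓs)
        Position i A B = (toℕ i < m × B ~ at w (suc (toℕ i)) × ¬ SameEdge G A B a b)
                       ⊎ (toℕ i ≡ m × A ≡ a × B ≡ b)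

        edgeAt : (i : Fin (suc m)) → ∃ λ A → ∃ λ B → R A B × (A ~ at w (toℕ i)) × Position i A B
        edgeAt i with m≤n⇒m<n∨m≡n (bound i)
        ... | inj₁ i<m = let A , B , e , f , r , _ , new = edge w (toℕ i) i<m
                         in A , B , r , e , inj₁ (i<m , f , new)
        ... | inj₂ i≡m = a , b , ab∈R , subst (λ j → a ~ at w j) (sym i≡m) (~-sym (end w)) ,
                         inj₂ (i≡m , refl , refl)

        target : ∀ {i j A B} → Position i A B → CycSucc (suc m) i j → B ~ at w (toℕ j)
        target (inj₁ (_ , f , _)) (inj₁ eq) = subst (λ l → _ ~ at w l) eq f
        target (inj₁ (i<m , _)) (inj₂ (eq , _)) = ⊥-elim (<-irrefl (suc-injective eq) i<m)
        target {j = j} (inj₂ (i≡m , _)) (inj₁ eq) =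
          ⊥-elim (<-irrefl refl (≤-trans (≤-reflexive (trans (cong suc (sym i≡m)) eq)) (bound j)))
        target (inj₂ (_ , _ , refl)) (inj₂ (_ , j≡0)) = subst (λ l → b ~ at w l) (sym j≡0) (start w)

        edges-distinct : ∀ {i j A B A′ B′} → i ≢ j → A ~ at w (toℕ i) → A′ ~ at w (toℕ j) →
          Position i A B → Position j A′ B′ → ¬ SameEdge G A B A′ B′
        edges-distinct i≢j _ _ (inj₂ (i≡m , _)) (inj₂ (j≡m , _)) _ =
          i≢j (toℕ-injective (trans i≡m (sym j≡m)))
        edges-distinct _ _ _ (inj₁ (_ , _ , new)) (inj₂ (_ , refl , refl)) s = new s
        edges-distinct {A′ = A′} {B′} _ _ _ (inj₂ (_ , refl , refl)) (inj₁ (_ , _ , new)) s =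
          new (SameEdge-sym {a} {b} {A′} {B′} s)
        edges-distinct {i} {j} i≢j src src′ (inj₁ _) (inj₁ _) (inj₁ (e , _)) =
          i≢j (toℕ-injective (shortest-injective w min (bound i) (bound j)
            (~-trans (~-sym src) (~-trans (≈⇒~ e) src′))))
        -- A walk edge traversed again in the opposite direction would force i + 1 = j and j + 1 =
        -- i.
        edges-distinct {i} {j} i≢j src src′ (inj₁ (i<m , f , _)) (inj₁ (j<m , f′ , _)) (inj₂ (e , e′)) =
          m≢1+n+m (toℕ j) {1} (trans (sym
            (shortest-injective w min i<m (bound j) (~-trans (~-sym f) (~-trans (≈⇒~ e′) src′))))
            (cong suc (shortest-injective w min (bound i) j<m
              (~-trans (~-sym src) (~-trans (≈⇒~ e) f′)))))

        closed : IsCycle G P _~_ R (suc m) (λ i → at w (toℕ i))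
                   (λ i → proj₁ (edgeAt i)) (λ i → proj₁ (proj₂ (edgeAt i)))
        closed =
            (λ i → vertex∈P (bound i))
          , (λ i → proj₁ (proj₂ (proj₂ (edgeAt i))))
          , source
          , (λ i j next → target (position i) next)
          , (λ i j i≢j ci~cj → i≢j (toℕ-injective (shortest-injective w min (bound i) (bound j) ci~cj)))
          , (λ i j i≢j → edges-distinct i≢j (source i) (source j) (position i) (position j))
          where
          source : ∀ i → proj₁ (edgeAt i) ~ at w (toℕ i)
          source i = proj₁ (proj₂ (proj₂ (proj₂ (edgeAt i))))
          position : ∀ i → Position i (proj₁ (edgeAt i)) (proj₁ (proj₂ (edgeAt i)))
          position i = proj₂ (proj₂ (proj₂ (proj₂ (edgeAt i))))

    -- A shortest detour from b to a, closed by ab, is a cycle. If the detour has length 0, then ab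
    -- is a loop of the quotient and the cycle has length 1.
    acyclic⇒bridge : IsAcyclicOn G P _~_ R → ∀ {a b} → P a → R a b → ¬ Star (Detour P _~_ R a b) b a
    acyclic⇒bridge acyclic {a} {b} a∈P ab∈R detour =
      let open Closing a∈P ab∈R
          _ , w , min = shortest em
            (Star-map (λ { (inj₁ r) → inj₁ r ; (inj₂ r) → inj₂ (_ , _ , ~-refl , ~-refl , r) }) detour)
      in acyclic _ (s≤s z≤n) _ _ _ (closed w min)

  module _ {ℓs} {_~_ : Rel (Clique G) ℓs} (~-equiv : IsEquivalence _~_)
    {k : ℕ} {c a b : Fin k → Clique G}
    (a~c : ∀ i → a i ~ c i) (b~c : ∀ i j → CycSucc k i j → b i ~ c j) (i₀ : Fin k) where
    open IsEquivalence ~-equiv renaming (refl to ~-refl; sym to ~-sym; trans to ~-trans)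

    OtherEdge : Rel (Clique G) (lsuc 0ℓ ⊔ ℓs)
    OtherEdge X Y = (X ~ Y) ⊎ ∃ λ j → j ≢ i₀ × X ≡ a j × Y ≡ b j

    -- Start at b i₀ and go round: `above` reaches the indices beyond i₀, `around` wraps to index 0
    -- (at once if i₀ is the last index), and `below` climbs from 0 back to i₀.
    cycle-detour : Star OtherEdge (b i₀) (a i₀)
    cycle-detour = below (toℕ i₀) i₀ refl ≤-refl ◅◅ return (inj₁ (~-sym (a~c i₀)))
      where
      advance : ∀ {i j} → i ≢ i₀ → CycSucc k i j → Star OtherEdge (b i₀) (c i) → Star OtherEdge (b i₀) (c j)
      advance {i} {j} i≢i₀ next rs =
        rs ◅◅ inj₁ (~-sym (a~c i)) ◅ inj₂ (i , i≢i₀ , refl , refl) ◅ inj₁ (b~c i j next) ◅ ε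

      above : ∀ n i → toℕ i ≡ suc n + toℕ i₀ → Star OtherEdge (b i₀) (c i)
      above zero    i eq = return (inj₁ (b~c i₀ i (inj₁ (sym eq))))
      above (suc n) i eq = advance i⁻≢i₀ (inj₁ (trans (cong suc toℕ-i⁻) (sym eq))) (above n i⁻ toℕ-i⁻)
        where
        i⁻<k : suc n + toℕ i₀ < k
        i⁻<k = <⇒≤ (subst (_< k) eq (toℕ<n i))
        i⁻ : Fin k
        i⁻ = fromℕ< i⁻<k
        toℕ-i⁻ : toℕ i⁻ ≡ suc n + toℕ i₀
        toℕ-i⁻ = toℕ-fromℕ< i⁻<k
        i⁻≢i₀ : i⁻ ≢ i₀
        i⁻≢i₀ i⁻≡i₀ = m≢1+n+m (toℕ i₀) (trans (cong toℕ (sym i⁻≡i₀)) toℕ-i⁻)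

      around : ∀ j → toℕ j ≡ 0 → ∀ n → k ≡ suc n + toℕ i₀ → Star OtherEdge (b i₀) (c j)
      around j j≡0 zero    eq = return (inj₁ (b~c i₀ j (inj₂ (sym eq , j≡0))))
      around j j≡0 (suc n) eq = advance l≢i₀ (inj₂ (trans (cong suc toℕ-l) (sym eq) , j≡0)) (above n l toℕ-l)
        where
        l<k : suc n + toℕ i₀ < k
        l<k = ≤-reflexive (sym eq)
        l : Fin k
        l = fromℕ< l<k
        toℕ-l : toℕ l ≡ suc n + toℕ i₀
        toℕ-l = toℕ-fromℕ< l<k
        l≢i₀ : l ≢ i₀
        l≢i₀ l≡i₀ = m≢1+n+m (toℕ i₀) (trans (cong toℕ (sym l≡i₀)) toℕ-l)

      below : ∀ n i → toℕ i ≡ n → n ≤ toℕ i₀ → Star OtherEdge (b i₀) (c i)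
      below zero i eq _ = around i eq (k ∸ suc (toℕ i₀))
        (sym (trans (sym (+-suc (k ∸ suc (toℕ i₀)) (toℕ i₀))) (m∸n+n≡m (toℕ<n i₀))))
      below (suc n) i eq n< = advance i⁻≢i₀ (inj₁ (trans (cong suc toℕ-i⁻) (sym eq))) (below n i⁻ toℕ-i⁻ (<⇒≤ n<))
        where
        n<k : n < k
        n<k = <⇒≤ (subst (_< k) eq (toℕ<n i))
        i⁻ : Fin k
        i⁻ = fromℕ< n<k
        toℕ-i⁻ : toℕ i⁻ ≡ n
        toℕ-i⁻ = toℕ-fromℕ< n<k
        i⁻≢i₀ : i⁻ ≢ i₀
        i⁻≢i₀ i⁻≡i₀ = <-irrefl (trans (sym toℕ-i⁻) (cong toℕ i⁻≡i₀)) n<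

-- Clique families F(C) and the equivalence ∼_F

module CliqueTreeBijection
  (em₀ : ExcludedMiddle 0ℓ) (em₁ : ExcludedMiddle (lsuc 0ℓ))
  (G : Graph) (finite : LocallyFinite G) (chordal : Chordal G) where
  open Graph G
  open Quotients G
  open Chordality em₀ G chordal

  infix 4 _⊑_ _⊏_ _≐_
  infixr 7 _⊓_

  _⊑_ : VSet G → VSet G → Set
  _⊑_ = _⊆_ G

  _⊏_ : VSet G → VSet G → Set
  C ⊏ D = (C ⊑ D) × ¬ (D ⊑ C)

  _≐_ : VSet G → VSet G → Set₁
  _≐_ = _≐F_ G

  _⊓_ : Clique G → Clique G → VSet G
  A ⊓ B = _∩_ G (proj₁ A) (proj₁ B)

  meet : Clique G → Clique G → CompleteSet G
  meet A B = A ⊓ B , λ u w p q → proj₁ (proj₂ A) u w (proj₁ p) (proj₁ q)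

  -- The converse fails: distinct complete sets can lie in exactly the same cliques.
  ⊑-antisym : ∀ {C D} → C ⊑ D → D ⊑ C → C ≐ D
  ⊑-antisym C⊑D D⊑C K = (λ C⊑K v → C⊑K v ∘ D⊑C v) , (λ D⊑K v → D⊑K v ∘ C⊑D v)

  ≐-sym : ∀ {C D} → C ≐ D → D ≐ C
  ≐-sym e K = swap (e K)

  ≐-trans : ∀ {C D D′} → C ≐ D → D ≐ D′ → C ≐ D′
  ≐-trans e f K = proj₁ (f K) ∘ proj₁ (e K) , proj₂ (e K) ∘ proj₂ (f K)

  ⊓-mono : ∀ {A A′ B B′} → A ≈ A′ → B ≈ B′ → A ⊓ B ⊑ A′ ⊓ B′
  ⊓-mono e f v (a , b) = proj₁ (e v) a , proj₁ (f v) b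

  ⊓-cong : ∀ {A A′ B B′} → A ≈ A′ → B ≈ B′ → A ⊓ B ≐ A′ ⊓ B′
  ⊓-cong {A} {A′} {B} {B′} e f =
    ⊑-antisym (⊓-mono {A} {A′} {B} {B′} e f) (⊓-mono {A′} {A} {B′} {B} (≈-sym {A} {A′} e) (≈-sym {B} {B′} f))

  ⊓-comm : ∀ {A B} → A ⊓ B ≐ B ⊓ A
  ⊓-comm = ⊑-antisym (λ _ → swap) (λ _ → swap)

  SameEdge⇒≐ : ∀ {A B A′ B′} → SameEdge G A B A′ B′ → A ⊓ B ≐ A′ ⊓ B′
  SameEdge⇒≐ {A} {B} {A′} {B′} (inj₁ (e , f)) = ⊓-cong {A} {A′} {B} {B′} e f
  SameEdge⇒≐ {A} {B} {A′} {B′} (inj₂ (e , f)) =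
    ≐-trans (⊓-cong {A} {B′} {B} {A′} e f) (⊓-comm {B′} {A′})

  InF-resp : ∀ {C A B} → A ≈ B → InF G C A → InF G C B
  InF-resp e a v = proj₁ (e v) ∘ a v

  CEdge-sym : ∀ {A B} → CEdge G A B → CEdge G B A
  CEdge-sym {A} {B} (A≉B , v , a , b) = A≉B ∘ ≈-sym {B} {A} , v , b , a

  CEdge-resp : ∀ {A A′ B B′} → A ≈ A′ → B ≈ B′ → CEdge G A B → CEdge G A′ B′
  CEdge-resp {A} {A′} {B} {B′} e f (A≉B , v , a , b) =
    (λ g → A≉B (≈-trans {A} {A′} {B} e (≈-trans {A′} {B′} {B} g (≈-sym {B} {B′} f))))
    , v , proj₁ (e v) a , proj₁ (f v) b

  module _ (C : CompleteSet G) where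

    EqEdge-sym : ∀ {A B} → EqEdge G C A B → EqEdge G C B A
    EqEdge-sym {A} {B} (a , b , e , eq) = b , a , CEdge-sym {A} {B} e , ≐-trans (⊓-comm {B} {A}) eq

    EqEdge-resp : ∀ {A A′ B B′} → A ≈ A′ → B ≈ B′ → EqEdge G C A B → EqEdge G C A′ B′
    EqEdge-resp {A} {A′} {B} {B′} f g (a , b , e , eq) =
      InF-resp {A = A} {A′} f a , InF-resp {A = B} {B′} g b , CEdge-resp {A} {A′} {B} {B′} f g e ,
      ≐-trans (≐-sym (⊓-cong {A} {A′} {B} {B′} f g)) eq

    LtEdge-sym : ∀ {A B} → LtEdge G C A B → LtEdge G C B A
    LtEdge-sym {A} {B} (a , b , e , lt , ne) =
      b , a , CEdge-sym {A} {B} e ,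
      (λ K h → lt K (proj₂ (⊓-comm {A} {B} K) h)) , ne ∘ ≐-trans (⊓-comm {A} {B})

    LtEdge-respˡ : ∀ {A A′ B} → A ≈ A′ → LtEdge G C A B → LtEdge G C A′ B
    LtEdge-respˡ {A} {A′} {B} f (a , b , e , lt , ne) =
      InF-resp {A = A} {A′} f a , b , CEdge-resp {A} {A′} {B} {B} f (≈-refl {B}) e ,
      (λ K h → lt K (proj₂ (eq K) h)) , ne ∘ ≐-trans eq
      where
      eq : A ⊓ B ≐ A′ ⊓ B
      eq = ⊓-cong {A} {A′} {B} {B} f (≈-refl {B})

    SimF-trans : ∀ {A B D} → SimF G C A B → SimF G C B D → SimF G C A D
    SimF-trans (step e s) s′ = step e (SimF-trans s s′)
    SimF-trans {A} {B} {D} (same e) (same f) = same (≈-trans {A} {B} {D} e f)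
    SimF-trans {A} {B} (same e) (step {X = X} f s) = step (LtEdge-respˡ {B} {A} {X} (≈-sym {A} {B} e) f) s

    SimF-sym : ∀ {A B} → SimF G C A B → SimF G C B A
    SimF-sym {A} {B} (same e) = same (≈-sym {A} {B} e)
    SimF-sym {A} (step {X = X} e s) =
      SimF-trans (SimF-sym s) (step {X = A} (LtEdge-sym {A} {X} e) (same (≈-refl {A})))

    SimF-isEquivalence : IsEquivalence (SimF G C)
    SimF-isEquivalence = record { refl = λ {A} → same (≈-refl {A}) ; sym = SimF-sym ; trans = SimF-trans }

    SimF-InF : ∀ {A B} → SimF G C A B → InF G (proj₁ C) A → InF G (proj₁ C) B
    SimF-InF {A} {B} (same e) a = InF-resp {A = A} {B} e a
    SimF-InF (step (_ , x , _) s) _ = SimF-InF s x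

  module _ {C D : CompleteSet G} (C≐D : proj₁ C ≐ proj₁ D) where

    EqEdge-≐ : ∀ {A B} → EqEdge G C A B → EqEdge G D A B
    EqEdge-≐ {A} {B} (a , b , e , eq) = proj₁ (C≐D A) a , proj₁ (C≐D B) b , e , ≐-trans eq C≐D

  -- Extending complete sets to cliques

  IsComplete-insert : ∀ {D y} → IsComplete G D → (∀ x → D x → x ∼ y) → IsComplete G (λ x → D x ⊎ x ≡ y)
  IsComplete-insert complete D∼y u w (inj₁ u∈D)  (inj₁ w∈D)  u≢w = complete u w u∈D w∈D u≢w
  IsComplete-insert complete D∼y u w (inj₁ u∈D)  (inj₂ refl) u≢w = D∼y u u∈D
  IsComplete-insert complete D∼y u w (inj₂ refl) (inj₁ w∈D)  u≢w = sym∼ (D∼y w w∈D)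
  IsComplete-insert complete D∼y u w (inj₂ refl) (inj₂ refl) u≢w = ⊥-elim (u≢w refl)

  -- The test whether x can be added is a conjunct of the membership predicate, so it need not be
  -- decided.
  greedy : List V → VSet G → VSet G
  greedy []      D = D
  greedy (x ∷ l) D = greedy l (λ u → D u ⊎ (u ≡ x × IsComplete G (λ w → D w ⊎ w ≡ x)))

  greedy-⊒ : ∀ l {D} → D ⊑ greedy l D
  greedy-⊒ []      v = id
  greedy-⊒ (x ∷ l) v = greedy-⊒ l v ∘ inj₁

  greedy-complete : ∀ l {D} → IsComplete G D → IsComplete G (greedy l D)
  greedy-complete []      complete = complete
  greedy-complete (x ∷ l) complete = greedy-complete l λ where
    u w (inj₁ p)           (inj₁ q)        → complete u w p q
    u w (inj₁ p)           (inj₂ (q , c))  → c u w (inj₁ p) (inj₂ q)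
    u w (inj₂ (p , c))     (inj₁ q)        → c u w (inj₂ p) (inj₁ q)
    u w (inj₂ (p , c))     (inj₂ (q , _))  → c u w (inj₂ p) (inj₂ q)

  -- When w was scanned, the current set together with w lay inside the complete set E, so w passed
  -- the test.
  greedy-maximal : ∀ l {D E} → IsComplete G E → greedy l D ⊑ E → ∀ {w} → w ∈ l → E w → greedy l D w
  greedy-maximal (x ∷ l) {D} complete ⊑E (here refl) w∈E =
    greedy-⊒ l x (inj₂ (refl , λ u v p q → complete u v (D∪x⊑E u p) (D∪x⊑E v q)))
    where
    D∪x⊑E : ∀ u → D u ⊎ u ≡ x → _
    D∪x⊑E u (inj₁ p)    = ⊑E u (greedy-⊒ l u (inj₁ p))
    D∪x⊑E u (inj₂ refl) = w∈E
  greedy-maximal (x ∷ l) complete ⊑E (there w∈l) w∈E = greedy-maximal l complete ⊑E w∈l w∈E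

  -- A complete set containing v consists of v and neighbours of v, so scanning a finite list that
  -- contains these neighbours already yields a maximal set.
  extend-to-clique : ∀ {D v} → IsComplete G D → D v → Σ (Clique G) λ K → D ⊑ proj₁ K
  extend-to-clique {D} {v} complete v∈D =
    (greedy l D , greedy-complete l complete , maximal) , greedy-⊒ l
    where
    l : List V
    l = proj₁ (finite v)
    maximal : ∀ E → IsComplete G E → greedy l D ⊑ E → E ⊑ greedy l D
    maximal E E-complete ⊑E w w∈E with em₀ {v ≡ w}
    ... | yes refl = greedy-⊒ l v v∈D
    ... | no v≢w   = greedy-maximal l E-complete ⊑E
      (proj₂ (finite v) w (E-complete v w (⊑E v (greedy-⊒ l v v∈D)) w∈E v≢w)) w∈E

  -- Cliques linked outside the intersection of two cliques

  module Separation (K₁ K₂ : Clique G) where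

    C : CompleteSet G
    C = meet K₁ K₂

    open AvoidingWalk (proj₁ C)

    -- X ∩ Y contains C and u. If F(X ∩ Y) were F(C), then u would lie in both K₁ and K₂, which are
    -- members of F(C), hence in K₁ ∩ K₂ = C.
    link : ∀ {X Y u} → InF G (proj₁ C) X → InF G (proj₁ C) Y → proj₁ X u → proj₁ Y u → ¬ proj₁ C u →
           SimF G C X Y
    link {X} {Y} {u} C⊑X C⊑Y u∈X u∈Y u∉C with em₀ {X ≈ Y}
    ... | yes X≈Y = same X≈Y
    ... | no X≉Y  = step {X = Y}
      ( C⊑X , C⊑Y , (X≉Y , u , u∈X , u∈Y)
      , (λ K h v v∈C → h v (C⊑X v v∈C , C⊑Y v v∈C))
      , λ eq → u∉C (proj₂ (eq K₁) (λ _ → proj₁) u (u∈X , u∈Y) , proj₂ (eq K₂) (λ _ → proj₂) u (u∈X , u∈Y)))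
      (same (≈-refl {Y}))

    -- The cliques in the middle of a stretch need not contain C, so no such inclusion is required.
    Outside : Rel (Clique G) 0ℓ
    Outside X Y = (X ≈ Y) ⊎ ∃ λ u → (X ⊓ Y) u × ¬ proj₁ C u

    VertexWalk : Rel (Clique G) 0ℓ
    VertexWalk X Y = ∃ λ u → ∃ λ w → (proj₁ X u × ¬ proj₁ C u) × (proj₁ Y w × ¬ proj₁ C w)
                   × Star (λ s t → (s ≡ t) ⊎ Avoid s t) u w

    -- Successive shared vertices lie in a common clique and outside C, so they are equal or
    -- adjacent in G - C.
    vertexWalk : ∀ {X Y} → Star Outside X Y → X ≈ Y ⊎ VertexWalk X Y
    vertexWalk {X} ε = inj₁ (≈-refl {X})
    vertexWalk {X} {Y} (_◅_ {j = Z} (inj₁ X≈Z) rs) with vertexWalk rs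
    ... | inj₁ Z≈Y = inj₁ (≈-trans {X} {Z} {Y} X≈Z Z≈Y)
    ... | inj₂ (u , w , (u∈Z , u∉C) , rest) = inj₂ (u , w , (proj₂ (X≈Z u) u∈Z , u∉C) , rest)
    vertexWalk {X} {Y} (_◅_ {j = Z} (inj₂ (u , (u∈X , u∈Z) , u∉C)) rs) with vertexWalk rs
    ... | inj₁ Z≈Y = inj₂ (u , u , (u∈X , u∉C) , (proj₁ (Z≈Y u) u∈Z , u∉C) , ε)
    ... | inj₂ (u′ , w , (u′∈Z , u′∉C) , w∈ , rest) =
      inj₂ (u , w , (u∈X , u∉C) , w∈ , jump (em₀ {u ≡ u′}) ◅ rest)
      where
      jump : Dec (u ≡ u′) → (u ≡ u′) ⊎ Avoid u u′
      jump (yes eq) = inj₁ eq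
      jump (no ne)  = inj₂ (proj₁ (proj₂ Z) u u′ u∈Z u′∈Z ne , u∉C , u′∉C)

    module _ {X Y : Clique G} (C⊑X : InF G (proj₁ C) X) (C⊑Y : InF G (proj₁ C) Y) where

      -- Both ends of the path lie in cliques containing C, so by `common-neighbours` every vertex
      -- of a shortest path is adjacent to all of C. Hence C together with two consecutive vertices
      -- is complete, and the cliques extending these sets lead from X to Y.
      vertexWalk⇒SimF : VertexWalk X Y → SimF G C X Y
      vertexWalk⇒SimF (u , w , (u∈X , u∉C) , (w∈Y , w∉C) , rs) =
        climb n ≤-refl Y C⊑Y (subst (proj₁ Y) (sym (end p)) w∈Y)
        where
        open WalkOf
        short : ∃ λ n → Σ (WalkOf n u w) Shortest
        short = shortest em₀ rs
        n : ℕ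
        n = proj₁ short
        p : WalkOf n u w
        p = proj₁ (proj₂ short)

        p∉C : ∀ {j} → j ≤ n → ¬ proj₁ C (at p j)
        p∉C {j} j≤n with m≤n⇒m<n∨m≡n j≤n
        ... | inj₁ j<n = proj₁ (proj₂ (edge p j j<n))
        ... | inj₂ refl = subst (¬_ ∘ proj₁ C) (sym (end p)) w∉C

        C∼ : ∀ {K v} → InF G (proj₁ C) K → proj₁ K v → ¬ proj₁ C v → ∀ c → proj₁ C c → c ∼ v
        C∼ {K} {v} C⊑K v∈K v∉C c c∈C =
          proj₁ (proj₂ K) c v (C⊑K c c∈C) v∈K (λ c≡v → v∉C (subst (proj₁ C) c≡v c∈C))

        C∼p : ∀ j → j ≤ n → ∀ c → proj₁ C c → c ∼ at p j
        C∼p j j≤n c c∈C =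
          common-neighbours p (proj₂ (proj₂ short)) p∉C c∈C
            (C∼ {X} C⊑X u∈X u∉C c c∈C) (C∼ {Y} C⊑Y w∈Y w∉C c c∈C) j j≤n

        -- K ranges over all cliques of F(C) through p_j, so that the induction can pass through M,
        -- which contains both p_j and p_(j+1).
        climb : ∀ j → j ≤ n → ∀ K → InF G (proj₁ C) K → proj₁ K (at p j) → SimF G C X K
        climb zero _ K C⊑K p₀∈K = link C⊑X C⊑K u∈X (subst (proj₁ K) (sym (start p)) p₀∈K) u∉C
        climb (suc j) j<n K C⊑K pⱼ∈K =
          SimF-trans C (climb j (<⇒≤ j<n) M (λ v → D⊑M v ∘ inj₁ ∘ inj₁) (D⊑M _ (inj₁ (inj₂ refl))))
            (link (λ v → D⊑M v ∘ inj₁ ∘ inj₁) C⊑K (D⊑M _ (inj₂ refl)) pⱼ∈K (p∉C j<n))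
          where
          M-D : Σ (Clique G) λ M → (λ v → (proj₁ C v ⊎ v ≡ at p j) ⊎ v ≡ at p (suc j)) ⊑ proj₁ M
          M-D = extend-to-clique
            (IsComplete-insert (IsComplete-insert (proj₂ C) (C∼p j (<⇒≤ j<n)))
              λ { v (inj₁ v∈C) → C∼p (suc j) j<n v v∈C ; v (inj₂ refl) → proj₁ (edge p j j<n) })
            (inj₂ refl)
          M : Clique G
          M = proj₁ M-D
          D⊑M = proj₂ M-D

      outside⇒SimF : Star Outside X Y → SimF G C X Y
      outside⇒SimF rs = Sum.[ same , vertexWalk⇒SimF ]′ (vertexWalk rs)

  -- From a clique tree to its components

  Total : Clique G → Set
  Total _ = ⊤

  module FromTree (T : EdgeRel G) (isTree : IsCliqueTree G T) where

    T⇒CEdge : ∀ {A B} → T A B → CEdge G A B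
    T⇒CEdge = proj₁ (proj₁ isTree) _ _

    T-sym : ∀ {A B} → T A B → T B A
    T-sym = proj₁ (proj₂ (proj₁ isTree)) _ _

    T-resp : ∀ {A A′ B B′} → A ≈ A′ → B ≈ B′ → T A B → T A′ B′
    T-resp {A} {A′} {B} {B′} = proj₂ (proj₂ (proj₁ isTree)) A A′ B B′

    bridge : ∀ {a b} → T a b → ¬ Star (Detour Total _≈_ T a b) b a
    bridge = acyclic⇒bridge {P = Total} ≈-isEquivalence id (λ _ _ → tt) em₁ (proj₂ (proj₁ (proj₂ isTree))) tt

    open ShortestWalk ≈-isEquivalence {E = T} (λ {A} {A′} {B} {B′} → T-resp {A} {A′} {B} {B′})
    open WalkOf

    -- If an edge of the path from A to B missed v ∈ A ∩ B, then the walk from A to B among the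
    -- cliques containing v would avoid that edge, which is therefore not a bridge.
    path-contains : ∀ {n A B} (p : WalkOf n A B) → Shortest p → ∀ l → l < n →
                    A ⊓ B ⊑ at p l ⊓ at p (suc l)
    path-contains {n} {A} {B} p min l l<n v (v∈A , v∈B) = decidable-stable em₀ λ v∉ →
      bridge {at p l} {at p (suc l)} (edge p l l<n)
        ( stretch (at p) l<n (λ j l<j j<n → inj₂ (edge p j j<n , tt , other (>⇒≢ l<j) j<n))
        ◅◅ inj₁ (end p)
        ◅ Star-map (λ { (inj₁ e) → inj₁ e
                      ; {X} {Y} (inj₂ (t , x , y)) → inj₂ (t , tt , v∉ ∘ both {X} {Y} x y) })
            (Walk⇒Star (λ K → proj₁ K v) _≈_ T ≈-isEquivalence (λ e → proj₁ (e v)) v∈B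
              (proj₁ (proj₂ (proj₂ isTree) v) B A v∈B v∈A))
        ◅◅ inj₁ (start p)
        ◅ stretch (at p) z≤n
            (λ j _ j<l → inj₂ (edge p j (<-trans j<l l<n) , tt , other (<⇒≢ j<l) (<-trans j<l l<n))))
      where
      other : ∀ {j} → j ≢ l → j < n → ¬ SameEdge G (at p j) (at p (suc j)) (at p l) (at p (suc l))
      other {j} j≢l j<n (inj₁ (e , _)) = j≢l (shortest-injective p min (<⇒≤ j<n) (<⇒≤ l<n) e)
      other {j} j≢l j<n (inj₂ (e , f)) =
        m≢1+n+m l {1} (trans (sym (shortest-injective p min j<n (<⇒≤ l<n) f))
          (cong suc (shortest-injective p min (<⇒≤ j<n) l<n e)))
      both : ∀ {X Y} → proj₁ X v → proj₁ Y v → SameEdge G X Y (at p l) (at p (suc l)) →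
             (at p l ⊓ at p (suc l)) v
      both x y (inj₁ (e , f)) = proj₁ (e v) x , proj₁ (f v) y
      both x y (inj₂ (e , f)) = proj₁ (f v) y , proj₁ (e v) x

    Over : VSet G → Rel (Clique G) 0ℓ
    Over C X Y = (X ≈ Y) ⊎ (T X Y × C ⊑ X ⊓ Y)

    tree-path : ∀ A B → Star (Over (A ⊓ B)) A B
    tree-path A B =
      let _ , p , min = shortest em₁ (Star-map (Sum.map₂ proj₁)
            (Walk⇒Star Total _≈_ T ≈-isEquivalence (λ _ _ → tt) tt (proj₁ (proj₁ (proj₂ isTree)) A B tt tt)))
      in inj₁ (start p) ◅
         stretch (at p) z≤n (λ l _ l<n → inj₂ (edge p l l<n , path-contains p min l l<n))
         ◅◅ return (inj₁ (end p))

    TreeEqEdge : CompleteSet G → Rel (Clique G) (lsuc 0ℓ)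
    TreeEqEdge C A B = T A B × EqEdge G C A B

    -- Excluded middle also serves to lower the universe level: an EdgeRel is valued in Set.
    component : CompleteSet G → EdgeRel G
    component C A B = True (em₁ {TreeEqEdge C A B})

    module _ {C : CompleteSet G} {A B : Clique G} where

      component-intro : TreeEqEdge C A B → component C A B
      component-intro = fromWitness {a? = em₁ {TreeEqEdge C A B}}

      component-elim : component C A B → TreeEqEdge C A B
      component-elim = toWitness {a? = em₁ {TreeEqEdge C A B}}

    component-compatible : ∀ C D → proj₁ C ≐ proj₁ D → ∀ A B → component C A B ⇔ component D A B
    component-compatible C D C≐D A B =
        (λ s → let t , e = component-elim {C} {A} {B} s in component-intro {D} {A} {B} (t , EqEdge-≐ {C} {D} C≐D {A} {B} e))
      , (λ s → let t , e = component-elim {D} {A} {B} s in component-intro {C} {A} {B} (t , EqEdge-≐ {D} {C} (≐-sym C≐D) {A} {B} e))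

    component-edges : ∀ C → IsEdgeSubset G (EqEdge G C) (component C)
    component-edges C =
        (λ A B s → proj₂ (component-elim {C} {A} {B} s))
      , (λ A B s → let t , e = component-elim {C} {A} {B} s in component-intro {C} {B} {A} (T-sym t , EqEdge-sym C {A} {B} e))
      , (λ A A′ B B′ f g s → let t , e = component-elim {C} {A} {B} s
                             in component-intro {C} {A′} {B′} (T-resp {A} {A′} {B} {B′} f g t ,
                                 EqEdge-resp C {A} {A′} {B} {B′} f g e))

    component-connected : ∀ C → IsConnectedOn G (InF G (proj₁ C)) (SimF G C) (component C)
    component-connected C A B C⊑A C⊑B =
      Star⇒Walk (InF G (proj₁ C)) (SimF G C) (component C) (SimF-isEquivalence C)
        (Star-map link (tree-path A B))
      where
      link : ∀ {X Y} → Over (A ⊓ B) X Y → Link (InF G (proj₁ C)) (SimF G C) (component C) X Y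
      link (inj₁ X≈Y) = inj₁ (same X≈Y)
      link {X} {Y} (inj₂ (t , A⊓B⊑)) with em₁ {X ⊓ Y ≐ proj₁ C}
      ... | yes eq = inj₂ (component-intro {C} {X} {Y} (t , C⊑X , C⊑Y , T⇒CEdge {X} {Y} t , eq) , C⊑X , C⊑Y)
        where
        C⊑X : InF G (proj₁ C) X
        C⊑X v c = proj₁ (A⊓B⊑ v (C⊑A v c , C⊑B v c))
        C⊑Y : InF G (proj₁ C) Y
        C⊑Y v c = proj₂ (A⊓B⊑ v (C⊑A v c , C⊑B v c))
      -- X ∩ Y contains C but defines another family, so XY is an edge of Γ^<(F) and gets
      -- contracted.
      ... | no ne = inj₁ (step {X = Y}
        ( (λ v c → proj₁ (A⊓B⊑ v (C⊑A v c , C⊑B v c)))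
        , (λ v c → proj₂ (A⊓B⊑ v (C⊑A v c , C⊑B v c)))
        , T⇒CEdge {X} {Y} t
        , (λ K h v c → h v (A⊓B⊑ v (C⊑A v c , C⊑B v c))) , ne)
        (same (≈-refl {Y})))

    -- The other edges of a cycle would give a detour in T around its edge 0: each contracted step
    -- expands to T-paths that avoid this edge.
    component-acyclic : ∀ C → IsAcyclicOn G (InF G (proj₁ C)) (SimF G C) (component C)
    component-acyclic C (suc k) _ c a b (_ , s , a~c , b~c , _ , distinct) =
      bridge (proj₁ (component-elim {C} {a zero} {b zero} (s zero)))
        ((expand ⋆) (cycle-detour (SimF-isEquivalence C) {a = a} {b} a~c b~c zero))
      where
      e₀ : EqEdge G C (a zero) (b zero)
      e₀ = proj₂ (component-elim {C} {a zero} {b zero} (s zero))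

      Detour₀ : Rel (Clique G) 0ℓ
      Detour₀ = Detour Total _≈_ T (a zero) (b zero)

      -- F(P ∩ Q) ⊆ F(X ∩ Y), which is strictly smaller than F(C), whereas edge 0 of the cycle has
      -- the family F(C).
      lt-avoids : ∀ {X Y P Q} → LtEdge G C X Y → X ⊓ Y ⊑ P ⊓ Q → ¬ SameEdge G P Q (a zero) (b zero)
      lt-avoids {X} {Y} {P} {Q} (_ , _ , _ , lt , ne) X⊓Y⊑ s =
        ne λ K → lt K , λ h v xy →
          proj₂ (≐-trans (SameEdge⇒≐ {P} {Q} {a zero} {b zero} s) (proj₂ (proj₂ (proj₂ e₀))) K) h v (X⊓Y⊑ v xy)

      SimF⇒detour : ∀ {X Y} → SimF G C X Y → Star Detour₀ X Y
      SimF⇒detour (same e) = return (inj₁ e)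
      SimF⇒detour {X} (step {X = Z} lt s) =
        Star-map (λ { (inj₁ e) → inj₁ e
                    ; {P} {Q} (inj₂ (t , ⊑PQ)) → inj₂ (t , tt , lt-avoids {X} {Z} {P} {Q} lt ⊑PQ) })
          (tree-path X Z)
        ◅◅ SimF⇒detour s

      expand : ∀ {X Y} → OtherEdge (SimF-isEquivalence C) {a = a} {b} a~c b~c zero X Y → Star Detour₀ X Y
      expand (inj₁ s) = SimF⇒detour s
      expand (inj₂ (j , j≢0 , refl , refl)) =
        return (inj₂ (proj₁ (component-elim {C} {a j} {b j} (s j)) , tt , distinct j zero j≢0))

    components : ProductCarrier G
    components =
      component , (λ C → component-edges C , component-connected C , component-acyclic C) , component-compatible

  -- From a family of spanning trees to a clique tree

  module FromComponents (S : CompleteSet G → EdgeRel G) (isTree : ∀ C → IsSpanningTreeQ G C (S C))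
    (compatible : ∀ C D → proj₁ C ≐ proj₁ D → ∀ A B → S C A B ⇔ S D A B) where

    S⇒EqEdge : ∀ {C A B} → S C A B → EqEdge G C A B
    S⇒EqEdge {C} = proj₁ (proj₁ (isTree C)) _ _

    union : EdgeRel G
    union A B = S (meet A B) A B

    -- An edge AB of `S C` has F(A ∩ B) = F(C), so compatibility moves it to the factor that `union`
    -- consults.
    S⇒union : ∀ {C A B} → S C A B → union A B
    S⇒union {C} {A} {B} s =
      let _ , _ , _ , eq = S⇒EqEdge {C} {A} {B} s in proj₂ (compatible (meet A B) C eq A B) s

    union⇒S : ∀ {C A B} → A ⊓ B ≐ proj₁ C → union A B → S C A B
    union⇒S {C} {A} {B} eq = proj₁ (compatible (meet A B) C eq A B)

    union-edges : IsEdgeSubset G (CEdge G) union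
    union-edges =
        (λ A B s → proj₁ (proj₂ (proj₂ (S⇒EqEdge {meet A B} {A} {B} s))))
      , (λ A B s → S⇒union {meet A B} {B} {A} (proj₁ (proj₂ (proj₁ (isTree (meet A B)))) A B s))
      , (λ A A′ B B′ e f s → S⇒union {meet A B} {A′} {B′}
          (proj₂ (proj₂ (proj₁ (isTree (meet A B)))) A A′ B B′ e f s))

    UnionLink : VSet G → Rel (Clique G) 0ℓ
    UnionLink C = Link (InF G C) _≈_ union

    UnionLink-mono : ∀ {C D} → C ⊑ D → ∀ {X Y} → UnionLink D X Y → UnionLink C X Y
    UnionLink-mono C⊑D (inj₁ e) = inj₁ e
    UnionLink-mono C⊑D (inj₂ (t , x , y)) = inj₂ (t , (λ v → x v ∘ C⊑D v) , (λ v → y v ∘ C⊑D v))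

    -- The induction step: a walk in the quotient consists of tree edges and Γ^<(F)-edges, and only
    -- the latter, whose intersections are larger than C, remain to be connected.
    connect-via : ∀ C → (∀ {X Y} → LtEdge G C X Y → Star (UnionLink (proj₁ C)) X Y) →
                  ∀ A B → InF G (proj₁ C) A → InF G (proj₁ C) B → Star (UnionLink (proj₁ C)) A B
    connect-via C lt A B C⊑A C⊑B =
      (expand ⋆) (Walk⇒Star (InF G (proj₁ C)) (SimF G C) (S C) (SimF-isEquivalence C) (SimF-InF C) C⊑A
        (proj₁ (proj₂ (isTree C)) A B C⊑A C⊑B))
      where
      SimF⇒links : ∀ {X Y} → SimF G C X Y → Star (UnionLink (proj₁ C)) X Y
      SimF⇒links (same e)   = return (inj₁ e)
      SimF⇒links {X} (step {X = Z} e s) = lt {X} {Z} e ◅◅ SimF⇒links s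

      expand : ∀ {X Y} → Link (InF G (proj₁ C)) (SimF G C) (S C) X Y → Star (UnionLink (proj₁ C)) X Y
      expand (inj₁ s) = SimF⇒links s
      expand {X} {Y} (inj₂ (s , x , y)) = return (inj₂ (S⇒union {C} {X} {Y} s , x , y))

    LtEdge⇒⊏ : ∀ {C X Y} → LtEdge G C X Y → proj₁ C ⊑ X ⊓ Y × ∃ λ u → (X ⊓ Y) u × ¬ proj₁ C u
    LtEdge⇒⊏ {C} {X} {Y} (C⊑X , C⊑Y , _ , _ , ne) = C⊑X⊓Y , decidable-stable em₀ λ none →
      ne (⊑-antisym (λ v xy → decidable-stable em₀ λ v∉C → none (v , xy , v∉C)) C⊑X⊓Y)
      where
      C⊑X⊓Y : proj₁ C ⊑ X ⊓ Y
      C⊑X⊓Y v c = C⊑X v c , C⊑Y v c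

    -- The list l bounds what the cliques of F(C) contain besides C; it shrinks as C grows.
    connect-bounded : ∀ n (l : List V) C → length l < n →
      (∀ K u → InF G (proj₁ C) K → proj₁ K u → ¬ proj₁ C u → u ∈ l) →
      ∀ A B → InF G (proj₁ C) A → InF G (proj₁ C) B → Star (UnionLink (proj₁ C)) A B
    connect-bounded (suc n) l C l< bounds = connect-via C grow
      where
      grow : ∀ {X Y} → LtEdge G C X Y → Star (UnionLink (proj₁ C)) X Y
      grow {X} {Y} lt with LtEdge⇒⊏ {C} {X} {Y} lt
      -- Since u lies in X ∩ Y but not in C, deleting u from l leaves a strictly shorter bound for
      -- the family of X ∩ Y.
      ... | C⊑ , u , (u∈X , u∈Y) , u∉C = Star-map (UnionLink-mono C⊑)
        (connect-bounded n (filter ≢u? l) (meet X Y)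
          (<-≤-trans (filter-notAll ≢u? l (Any.map (λ u≡w w≢u → w≢u (sym u≡w)) (bounds X u (proj₁ lt) u∈X u∉C)))
            (≤-pred l<))
          (λ K w h w∈K w∉ → ∈-filter⁺ ≢u? (bounds K w (λ v → h v ∘ C⊑ v) w∈K (w∉ ∘ C⊑ w))
            (λ w≡u → w∉ (subst (X ⊓ Y) (sym w≡u) (u∈X , u∈Y))))
          X Y (λ _ → proj₁) (λ _ → proj₂))
        where
        ≢u? : ∀ w → Dec (w ≢ u)
        ≢u? w = em₀

    -- C may be empty, and then no finite list need bound F(C). After one step X ∩ Y contains a
    -- vertex v, and the neighbours of v provide the bound.
    connect : ∀ C A B → InF G (proj₁ C) A → InF G (proj₁ C) B → Star (UnionLink (proj₁ C)) A B
    connect C = connect-via C λ {X} {Y} lt →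
      let C⊑ , _ = LtEdge⇒⊏ {C} {X} {Y} lt
          _ , _ , (_ , v , v∈X , v∈Y) , _ = lt
          l , nbrs = finite v
      in Star-map (UnionLink-mono C⊑)
           (connect-bounded (suc (length l)) l (meet X Y) ≤-refl
             (λ K u h u∈K u∉ → nbrs u (proj₁ (proj₂ K) v u (h v (v∈X , v∈Y)) u∈K
               (λ v≡u → u∉ (subst (X ⊓ Y) v≡u (v∈X , v∈Y)))))
             X Y (λ _ → proj₁) (λ _ → proj₂))

    -- With C the intersection at i₀, the rest of the cycle becomes a walk in Γ^=(F)/∼_F between the
    -- ends of edge i₀, which is then no bridge of `S C`.
    no-cycle-at : ∀ {k} {c a b : Fin k → Clique G} → IsCycle G Total _≈_ union k c a b →
                  ∀ i₀ → ¬ (∀ j → ¬ (a j ⊓ b j ⊏ a i₀ ⊓ b i₀))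
    no-cycle-at {k} {c} {a} {b} (_ , t , a~c , b~c , _ , distinct) i₀ least =
      acyclic⇒bridge (SimF-isEquivalence C) same (SimF-InF C) em₁ (proj₂ (proj₂ (isTree C)))
        {a i₀} {b i₀} (λ _ → proj₁) (t i₀)
        (contract (λ _ → proj₂) ε (cycle-detour ≈-isEquivalence {c = c} {a} {b} a~c b~c i₀))
      where
      open Separation (a i₀) (b i₀)

      Other : Rel (Clique G) (lsuc 0ℓ)
      Other = OtherEdge ≈-isEquivalence {c = c} {a} {b} a~c b~c i₀

      Detour₀ : Rel (Clique G) (lsuc 0ℓ)
      Detour₀ = Detour (InF G (proj₁ C)) (SimF G C) (S C) (a i₀) (b i₀)

      -- L is the last clique of F(C) recorded, and `out` is the pending stretch from L to X. An
      -- edge with intersection C, or the end of the walk, closes the stretch; both its ends then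
      -- contain C, so it becomes a ∼_F-equivalence.
      contract : ∀ {L X} → InF G (proj₁ C) L → Star Outside L X → Star Other X (a i₀) → Star Detour₀ L (a i₀)
      contract C⊑L out ε = return (inj₁ (outside⇒SimF C⊑L (λ _ → proj₁) out))
      contract C⊑L out (inj₁ e ◅ rs) = contract C⊑L (out ◅◅ return (inj₁ e)) rs
      contract C⊑L out (inj₂ (j , j≢i₀ , refl , refl) ◅ rs)
        with em₀ {∃ λ u → (a j ⊓ b j) u × ¬ proj₁ C u}
      ... | yes outside = contract C⊑L (out ◅◅ return (inj₂ outside)) rs
      ... | no  none    =
        inj₁ (outside⇒SimF C⊑L (λ v → proj₁ ∘ C⊑ v) out)
          ◅ inj₂ (union⇒S {C} {a j} {b j} (⊑-antisym ⊑C C⊑) (t j) , (λ v → proj₁ ∘ C⊑ v) , distinct j i₀ j≢i₀)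
          ◅ contract (λ v → proj₂ ∘ C⊑ v) ε rs
        where
        ⊑C : a j ⊓ b j ⊑ proj₁ C
        ⊑C v v∈ = decidable-stable em₀ λ v∉C → none (v , v∈ , v∉C)
        C⊑ : proj₁ C ⊑ a j ⊓ b j
        -- An intersection properly inside C would contradict the minimality of edge i₀.
        C⊑ = decidable-stable em₀ λ C⋢ → least j (⊑C , C⋢)

    union-acyclic : IsAcyclicOn G Total _≈_ union
    union-acyclic (suc k) _ c a b cycle =
      let i₀ , least = minimal em₀ (spo-wellFounded {_⊏_ = λ i j → a i ⊓ b i ⊏ a j ⊓ b j} (record
            { isEquivalence = isEquivalence
            ; irrefl        = λ { refl (p , ¬p) → ¬p p }
            ; trans         = λ (p , ¬p) (q , ¬q) → (λ v → q v ∘ p v) , λ r → ¬p (λ v → r v ∘ q v)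
            ; <-resp-≈      = resp₂ _
            })) zero
      in no-cycle-at {c = c} {a} {b} cycle i₀ least

    -- C = ∅ gives connectedness of the whole tree and C = {v} that of the part at v; a cycle in a
    -- part is a cycle in the whole.
    cliqueTree : IsCliqueTree G union
    cliqueTree = union-edges
      , ( (λ A B _ _ → Star⇒Walk Total _≈_ union ≈-isEquivalence
            (Star-map (Sum.map₂ (λ (t , _) → t , tt , tt)) (connect (∅ , λ _ _ ()) A B (λ _ ()) (λ _ ()))))
        , union-acyclic )
      , λ v →
          (λ A B v∈A v∈B → Star⇒Walk (λ K → proj₁ K v) _≈_ union ≈-isEquivalence
            (Star-map (Sum.map₂ (λ (t , x , y) → t , x v refl , y v refl))
              (connect (singleton v) A B (λ { _ refl → v∈A }) (λ { _ refl → v∈B }))))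
        , λ k 1≤k c a b (_ , rest) → union-acyclic k 1≤k c a b ((λ _ → tt) , rest)
      where
      ∅ : VSet G
      ∅ _ = ⊥
      singleton : V → CompleteSet G
      singleton v = (λ u → u ≡ v) , λ u w u≡v w≡v u≢w → ⊥-elim (u≢w (trans u≡v (sym w≡v)))

  -- The bijection

  bijection : Bijection (CliqueTrees G) (SpanningTreeProduct G)
  bijection = record
    { to        = λ (T , isTree) → FromTree.components T isTree
    ; cong      = λ {x} {y} → to-cong {x} {y}
    ; bijective = (λ {x} {y} → to-injective {x} {y}) , to-surjective
    }
    where
    open Setoid (CliqueTrees G) using () renaming (Carrier to Trees; _≈_ to _≈ᵀ_)
    open Setoid (SpanningTreeProduct G) using () renaming (_≈_ to _≈ᴾ_)

    to : Trees → ProductCarrier G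
    to (T , isTree) = FromTree.components T isTree

    transport : ∀ (x y : Trees) C A B → (proj₁ x A B → proj₁ y A B) → proj₁ (to x) C A B → proj₁ (to y) C A B
    transport (T , isTree) (T′ , isTree′) C A B T⇒T′ s =
      let t , e = FromTree.component-elim T isTree {C} {A} {B} s
      in FromTree.component-intro T′ isTree′ {C} {A} {B} (T⇒T′ t , e)

    to-cong : ∀ {x y} → x ≈ᵀ y → to x ≈ᴾ to y
    to-cong {x} {y} eq C A B = transport x y C A B (proj₁ (eq A B)) , transport y x C A B (proj₂ (eq A B))

    -- An edge AB of a clique tree lies in the factor of its own intersection, so the tree can be
    -- read off from its factors.
    recover : ∀ (x y : Trees) → (∀ C A B → proj₁ (to x) C A B → proj₁ (to y) C A B) →
              ∀ A B → proj₁ x A B → proj₁ y A B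
    recover (T , isTree) (T′ , isTree′) x⇒y A B t =
      proj₁ (FromTree.component-elim T′ isTree′ {meet A B} {A} {B} (x⇒y (meet A B) A B
        (FromTree.component-intro T isTree {meet A B} {A} {B}
          (t , (λ _ → proj₁) , (λ _ → proj₂) , FromTree.T⇒CEdge T isTree t , λ _ → id , id))))

    to-injective : ∀ {x y} → to x ≈ᴾ to y → x ≈ᵀ y
    to-injective {x} {y} eq A B =
      recover x y (λ C A B → proj₁ (eq C A B)) A B , recover y x (λ C A B → proj₂ (eq C A B)) A B

    -- The part at C of a tree equal to `union` consists of the union edges with F(A ∩ B) = F(C),
    -- which compatibility identifies with the edges of `S C`.
    to-surjective : ∀ y → ∃ λ x → ∀ {z} → z ≈ᵀ x → to z ≈ᴾ y
    to-surjective (S , isTree , compatible) = (union , cliqueTree) , λ {(T , isTreeT)} z≈x C A B →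
        (λ s → let t , (_ , _ , _ , eq) = FromTree.component-elim T isTreeT {C} {A} {B} s
               in union⇒S {C} {A} {B} eq (proj₁ (z≈x A B) t))
      , (λ s → FromTree.component-intro T isTreeT {C} {A} {B}
               (proj₂ (z≈x A B) (S⇒union {C} {A} {B} s) , S⇒EqEdge {C} {A} {B} s))
      where open FromComponents S isTree compatible

theorem3p5 : ExcludedMiddle 0ℓ → ExcludedMiddle (lsuc 0ℓ) →
    (G : Graph) → Connected G → LocallyFinite G → Chordal G →
    Bijection (CliqueTrees G) (SpanningTreeProduct G)
theorem3p5 em₀ em₁ G _ finite chordal = CliqueTreeBijection.bijection em₀ em₁ G finite chordal
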